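{- Let $G=(V,E)$ be a finite factor-critical graph given with an odd ear-decomposition $G=P_0+P_1+\cdots+P_k$, and let $e=ab\in E$ be an odd edge (with respect to this ear-decomposition) that is an edge of a nontrivial ear. Then for any vertex $v\in V$ with $\mathrm{ear}(v)<\mathrm{ear}(a)=\mathrm{ear}(b)$, there exists a perfect matching of $G-v$ containing $e$.
   Context: Graphs are finite, without loops or parallel edges. A matching is a set of pairwise vertex-disjoint edges; it is perfect if it covers all vertices. A graph $G$ is factor-critical if $G-v$ has a perfect matching for every vertex $v$. An ear-decomposition $G=P_0+P_1+\cdots+P_k$ consists of a circuit $P_0$ and paths $P_1,\ldots,P_k$ whose edge sets partition the edge set of $G$ and whose vertex sets together cover $V(G)$, such that for each $i\in\{1,\ldots,k\}$ the path $P_i$ (which has at least one edge) shares exactly its endpoints with $V(P_0)\cup\cdots\cup V(P_{i-1})$. The two endpoints of $P_i$ may coincide, in which case $P_i$ is a circuit having exactly one vertex, its "endpoint", in common with $V(P_0)\cup\cdots\cup V(P_{i-1})$. The $P_i$ are called ears. An ear is trivial if it consists of a single edge, and nontrivial otherwise. An ear is odd if it has an odd number of edges. The ear-decomposition is odd if all of $P_0,P_1,\ldots,P_k$ (including the circuit $P_0$) have an odd number of edges. For $v\in V$, $\mathrm{ear}(v)$ is the smallest index $i\in\{0,\ldots,k\}$ with $v\in V(P_i)$. Given an ear-decomposition, an edge $e=ab$ of $G$ is called odd if $\mathrm{ear}(a)=\mathrm{ear}(b)=:i$ and, in case $i\ge 1$, additionally: $a$ is joined to an endpoint of $P_i$ by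 a subpath of $P_i$ that has an odd number of edges and does not contain $b$, and likewise $b$ is joined to an endpoint of $P_i$ by a subpath of $P_i$ that has an odd number of edges and does not contain $a$. -}

module Defs where

open import Data.Fin.Base as Fin using (Fin; zero; suc; inject₁; fromℕ)
open import Data.Fin.Properties using (_≟_)
open import Data.Fin.Subset using (Subset; _∈_; _-_)
open import Data.Fin.Subset.Properties using (x∈p∧x≢y⇒x∈p-y)
open import Data.List.Base using (List)
open import Data.List.Relation.Unary.All using (All)
open import Data.List.Relation.Unary.Any using (Any)
open import Data.List.Relation.Unary.AllPairs using (AllPairs)
open import Data.Nat.Base using (ℕ; suc; _≤_; parity)
open import Data.Parity.Base using (1ℙ)
open import Data.Product using (_×_; _,_; ∃!; ∃-syntax; Σ-syntax; uncurry)
open import Data.Sum.Base using (_⊎_)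
open import Function.Base using (_∘_)
open import Function.Bundles using (_⇔_)
open import Function.Definitions using (Injective)
open import Level using (0ℓ)
open import Relation.Binary.Core using (Rel)
open import Relation.Binary.Definitions using (Symmetric; Irreflexive; Decidable)
open import Relation.Binary.PropositionalEquality using (_≡_; _≢_)
open import Relation.Nullary using (¬_)
open import Relation.Nullary.Decidable using (_×-dec_; ¬?)

Odd : ℕ → Set
Odd m = parity m ≡ 1ℙ

-- A finite simple graph whose vertex set is a subset of Fin n, so that
-- deleting a vertex does not rename the others.
record Graph (n : ℕ) : Set₁ where
  field
    V        : Subset n
    E        : Rel (Fin n) 0ℓ
    E-dec    : Decidable E
    E-sym    : Symmetric E
    E-irrefl : Irreflexive _≡_ E
    E⇒V      : ∀ {a b} → E a b → a ∈ V

open Graph public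

infixl 5 _∖_

_∖_ : ∀ {n} → Graph n → Fin n → Graph n
G ∖ v = record
  { V        = V G - v
  ; E        = λ a b → E G a b × a ≢ v × b ≢ v
  ; E-dec    = λ a b → E-dec G a b ×-dec ¬? (a ≟ v) ×-dec ¬? (b ≟ v)
  ; E-sym    = λ (e , a≢v , b≢v) → E-sym G e , b≢v , a≢v
  ; E-irrefl = λ a≡b (e , _) → E-irrefl G a≡b e
  ; E⇒V      = λ (e , a≢v , _) → x∈p∧x≢y⇒x∈p-y (E⇒V G e) a≢v
  }

-- An unordered pair {a , b} may be listed as either (a , b) or (b , a).
EdgeSet : ℕ → Set
EdgeSet n = List (Fin n × Fin n)

Covers : ∀ {n} → Fin n → Fin n × Fin n → Set
Covers v (a , b) = v ≡ a ⊎ v ≡ b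

Disjoint : ∀ {n} → Rel (Fin n × Fin n) 0ℓ
Disjoint e f = ∀ v → ¬ (Covers v e × Covers v f)

IsMatching : ∀ {n} → Graph n → EdgeSet n → Set
IsMatching G M = All (uncurry (E G)) M × AllPairs Disjoint M

IsPerfectMatching : ∀ {n} → Graph n → EdgeSet n → Set
IsPerfectMatching G M = IsMatching G M × (∀ v → v ∈ V G → Any (Covers v) M)

Contains : ∀ {n} → EdgeSet n → Fin n → Fin n → Set
Contains M a b = Any (λ e → e ≡ (a , b) ⊎ e ≡ (b , a)) M

FactorCritical : ∀ {n} → Graph n → Set
FactorCritical G = ∀ v → v ∈ V G → ∃[ M ] IsPerfectMatching (G ∖ v) M

-- A vertex sequence w₀ , … , w_len; its edges are the pairs {wᵢ , wᵢ₊₁}.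
record Walk (n : ℕ) : Set where
  field
    len    : ℕ
    vertex : Fin (suc len) → Fin n

  first last : Fin n
  first = vertex zero
  last  = vertex (fromℕ len)

open Walk public

infix 4 _onWalk_ _⊑_

_onWalk_ : ∀ {n} → Fin n → Walk n → Set
v onWalk W = ∃[ i ] vertex W i ≡ v

EdgeOf : ∀ {n} → Walk n → Fin n → Fin n → Set
EdgeOf W a b = Σ[ i ∈ Fin (len W) ]
  ( (vertex W (inject₁ i) ≡ a × vertex W (suc i) ≡ b)
  ⊎ (vertex W (inject₁ i) ≡ b × vertex W (suc i) ≡ a))

IsEndpoint : ∀ {n} → Fin n → Walk n → Set
IsEndpoint v W = v ≡ first W ⊎ v ≡ last W

IsPath : ∀ {n} → Walk n → Set
IsPath W = Injective _≡_ _≡_ (vertex W)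

-- The circuit is written with its base vertex both first and last.
IsCircuit : ∀ {n} → Walk n → Set
IsCircuit W =
  3 ≤ len W × first W ≡ last W × Injective _≡_ _≡_ (vertex W ∘ inject₁)

_⊑_ : ∀ {n} → Walk n → Walk n → Set
Q ⊑ P = (∀ {v} → v onWalk Q → v onWalk P)
      × (∀ {a b} → EdgeOf Q a b → EdgeOf P a b)

record EarDecomposition {n} (G : Graph n) (k : ℕ) : Set where
  field
    ear-walk  : Fin (suc k) → Walk n
    base      : IsCircuit (ear-walk zero)
    -- A closed ear is based at the vertex it shares with the earlier ears.
    ears      : ∀ (i : Fin k) → let P = ear-walk (suc i) in
                (IsPath P × 1 ≤ len P) ⊎ IsCircuit P
    shared    : ∀ (i : Fin k) {v} → let P = ear-walk (suc i) in
                v onWalk P →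
                (∃[ j ] (j Fin.< suc i × v onWalk ear-walk j)) ⇔ IsEndpoint v P
    edges-⊆   : ∀ i {a b} → EdgeOf (ear-walk i) a b → E G a b
    partition : ∀ {a b} → E G a b →
                ∃! _≡_ (λ i → EdgeOf (ear-walk i) a b)
    cover     : ∀ {v} → v ∈ V G → ∃[ i ] v onWalk ear-walk i

open EarDecomposition public

module _ {n} {G : Graph n} {k} (D : EarDecomposition G k) where

  OddDecomposition : Set
  OddDecomposition = ∀ i → Odd (len (ear-walk D i))

  Nontrivial : Fin (suc k) → Set
  Nontrivial i = len (ear-walk D i) ≢ 1

  -- ear(v) = i, as a functional relation.
  Ear : Fin n → Fin (suc k) → Set
  Ear v i = v onWalk ear-walk D i × (∀ j → j Fin.< i → ¬ v onWalk ear-walk D j)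

  OddlyJoined : Fin (suc k) → Fin n → Fin n → Set
  OddlyJoined i a b = ∃[ Q ]
    ( IsPath Q
    × Q ⊑ ear-walk D i
    × first Q ≡ a
    × IsEndpoint (last Q) (ear-walk D i)
    × Odd (len Q)
    × ¬ b onWalk Q)

  OddEdge : Fin n → Fin n → Set
  OddEdge a b = E G a b × ∃[ i ]
    ( Ear a i
    × Ear b i
    × (1 ≤ Fin.toℕ i → OddlyJoined i a b × OddlyJoined i b a))

{-# OPTIONS --safe #-}

-- The interior vertices of an odd ear can be matched along it, in exactly one way, and the
-- edges used are those leaving an odd position; an odd edge of a nontrivial ear is one of
-- them.  Every prefix P₀ + ⋯ + Pᵢ₋₁ of the decomposition is factor-critical: a vertex t of
-- the last ear is missed by matching along the ear on both sides of t, which uses up the end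
-- of the ear at even distance from t, and this end is the vertex missed in the shorter prefix.
-- So a perfect matching of P₀ + ⋯ + Pᵢ₋₁ − v, together with the interior matchings of Pᵢ and
-- of all later ears, is a perfect matching of G − v through the given odd edge of Pᵢ.
module Submission where

open import Defs
open import Data.Nat.Base using (ℕ; zero; suc; _+_; _*_; _≤_; _<_; z≤n; s≤s; parity)
open import Data.Nat.Properties
open import Data.Fin.Base as Fin using (Fin)
import Data.Fin.Properties as Fin
open import Data.Fin.Subset using (_∈_; Subset; _─_; inside; outside)
open import Data.Fin.Subset.Properties using (p─q⊆p; x∈⁅x⁆)
open import Data.Vec.Base using (_∷_; here; there)
open import Data.List.Base using ([]; _∷_; _++_)
open import Data.List.Membership.Propositional using (lose) renaming (_∈_ to _∈ˡ_)
open import Data.List.Relation.Unary.All as All using ([]; _∷_)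
import Data.List.Relation.Unary.All.Properties as All
open import Data.List.Relation.Unary.AllPairs using ([]; _∷_)
import Data.List.Relation.Unary.AllPairs.Properties as AllPairs
open import Data.List.Relation.Unary.Any as Any using (Any; here; there)
import Data.List.Relation.Unary.Any.Properties as Any
open import Data.Parity.Base using (_⁻¹)
open import Data.Parity.Properties using (suc-homo-⁻¹)
open import Data.Product using (_×_; _,_; proj₁; proj₂; ∃-syntax)
open import Data.Sum.Base using (_⊎_; inj₁; inj₂; [_,_]′)
open import Data.Empty using (⊥-elim)
open import Function.Base using (_∘_; case_of_)
open import Function.Bundles using (module Equivalence)
open import Level using (0ℓ)
open import Relation.Binary.Definitions using (tri<; tri≈; tri>)
open import Relation.Binary.PropositionalEquality
  using (_≡_; _≢_; refl; sym; trans; cong; subst)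
open import Relation.Nullary using (¬_; yes; no; contradiction)
open import Relation.Unary using (Pred; _∪_; _≐_)

-- Halving odd and even numbers.

odd⇒1+2* : ∀ m → Odd m → ∃[ d ] m ≡ suc (d * 2)
odd⇒1+2* (suc zero)    _ = 0 , refl
odd⇒1+2* (suc (suc m)) o with odd⇒1+2* m o
... | d , refl = suc d , refl

even⊎odd : ∀ m → ∃[ d ] (m ≡ d * 2 ⊎ m ≡ suc (d * 2))
even⊎odd zero    = 0 , inj₁ refl
even⊎odd (suc m) with even⊎odd m
... | d , inj₁ refl = d , inj₂ refl
... | d , inj₂ refl = suc d , inj₁ refl

-- Matchings that cover a prescribed vertex set.

infixl 6 _⊖_

_⊖_ : ∀ {n} → Pred (Fin n) 0ℓ → Fin n → Pred (Fin n) 0ℓ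
(A ⊖ v) u = A u × u ≢ v

Covered : ∀ {n} → EdgeSet n → Pred (Fin n) 0ℓ
Covered M u = Any (Covers u) M

Segment : ∀ {n} → (ℕ → Fin n) → ℕ → ℕ → Pred (Fin n) 0ℓ
Segment w s e u = ∃[ m ] (s ≤ m × m < e × w m ≡ u)

alternate : ∀ {n} → (ℕ → Fin n) → ℕ → ℕ → EdgeSet n
alternate w s zero    = []
alternate w s (suc c) = (w s , w (suc s)) ∷ alternate w (suc (suc s)) c

-- With `s` equal to 1 this shows that every edge leaving an odd position within range is chosen;
-- the odd edge will be recognised in this way.
alternate-∋ : ∀ {n} (w : ℕ → Fin n) s {m c} → m < c →
  (w (s + m * 2) , w (suc (s + m * 2))) ∈ˡ alternate w s c
alternate-∋ w s {zero}  {suc c} _ rewrite +-identityʳ s = here refl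
alternate-∋ w s {suc m} {suc c} (s≤s m<c)
  rewrite +-suc s (suc (m * 2)) | +-suc s (m * 2) = there (alternate-∋ w (suc (suc s)) m<c)

module _ {n} (G : Graph n) where

  -- Recording exactly which vertices are covered lets matchings be glued: disjoint covered sets
  -- already force disjoint edges. A perfect matching of `G ∖ v` is the case where `A` is all of
  -- `V G` except `v`.
  Matches : Pred (Fin n) 0ℓ → EdgeSet n → Set
  Matches A M = IsMatching G M × Covered M ≐ A

  Matches-resp-≐ : ∀ {A B M} → A ≐ B → Matches A M → Matches B M
  Matches-resp-≐ (A⊆B , B⊆A) (m , M⊆A , A⊆M) = m , A⊆B ∘ M⊆A , A⊆M ∘ B⊆A

  Matches-[] : ∀ {A} → (∀ u → ¬ A u) → Matches A []
  Matches-[] ∅ = ([] , []) , (λ ()) , λ {u} Au → ⊥-elim (∅ u Au)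

  Matches-++ : ∀ {A B M N} → (∀ {u} → A u → ¬ B u) →
    Matches A M → Matches B N → Matches (A ∪ B) (M ++ N)
  Matches-++ {M = M} A∩B=∅ ((M⊆E , M-disj) , M⊆A , A⊆M) ((N⊆E , N-disj) , N⊆B , B⊆N) =
      ( All.++⁺ M⊆E N⊆E
      , AllPairs.++⁺ M-disj N-disj
          (All.tabulate λ e∈M → All.tabulate λ f∈N u (u∈e , u∈f) →
            A∩B=∅ (M⊆A (lose e∈M u∈e)) (N⊆B (lose f∈N u∈f))))
    , [ inj₁ ∘ M⊆A , inj₂ ∘ N⊆B ]′ ∘ Any.++⁻ M
    , [ Any.++⁺ˡ ∘ A⊆M , Any.++⁺ʳ M ∘ B⊆N ]′

  Matches-edge : ∀ {a b} → E G a b → Matches (λ u → Covers u (a , b)) ((a , b) ∷ [])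
  Matches-edge e = (e ∷ [] , [] ∷ []) , (λ { (here c) → c }) , here

  -- The half-open range from `s` to `e` holds `2c` positions, so it can be paired off from the
  -- left; each step removes the first edge and restarts two positions later.
  Matches-alternate : ∀ (w : ℕ → Fin n) c {s e} → s + c * 2 ≡ e →
    (∀ {m} → s ≤ m → suc m < e → E G (w m) (w (suc m))) →
    (∀ {m m′} → s ≤ m → m < m′ → m′ < e → w m ≢ w m′) →
    Matches (Segment w s e) (alternate w s c)
  Matches-alternate w zero {s} refl _ _ = Matches-[] λ { u (m , s≤m , m<e , _) →
    <⇒≱ m<e (≤-trans (≤-reflexive (+-identityʳ s)) s≤m) }
  Matches-alternate w (suc c) {s} {e} eq edge distinct =
    Matches-resp-≐ (to , from)
      (Matches-++ disj (Matches-edge (edge ≤-refl 1+s<e))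
        (Matches-alternate w c eq′ (edge ∘ 2+≤) (distinct ∘ 2+≤)))
    where
    2+≤ : ∀ {m} → suc (suc s) ≤ m → s ≤ m
    2+≤ = <⇒≤ ∘ <⇒≤
    eq′ : suc (suc s) + c * 2 ≡ e
    eq′ = trans (sym (trans (+-suc s (suc (c * 2))) (cong suc (+-suc s (c * 2))))) eq
    1+s<e : suc s < e
    1+s<e = ≤-trans (m≤m+n (suc (suc s)) (c * 2)) (≤-reflexive eq′)
    disj : ∀ {u} → Covers u (w s , w (suc s)) → ¬ Segment w (suc (suc s)) e u
    disj (inj₁ refl) (m , s≤m , m<e , wm≡) = distinct ≤-refl (<⇒≤ s≤m) m<e (sym wm≡)
    disj (inj₂ refl) (m , s≤m , m<e , wm≡) = distinct (n≤1+n s) s≤m m<e (sym wm≡)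
    to : ∀ {u} → (Covers u (w s , w (suc s)) ⊎ Segment w (suc (suc s)) e u) → Segment w s e u
    to (inj₁ (inj₁ refl)) = s , ≤-refl , <⇒≤ 1+s<e , refl
    to (inj₁ (inj₂ refl)) = suc s , n≤1+n s , 1+s<e , refl
    to (inj₂ (m , s≤m , m<e , wm≡u)) = m , 2+≤ s≤m , m<e , wm≡u
    from : ∀ {u} → Segment w s e u → (Covers u (w s , w (suc s)) ⊎ Segment w (suc (suc s)) e u)
    from (m , s≤m , m<e , wm≡u) with m≤n⇒m<n∨m≡n s≤m
    ... | inj₂ refl = inj₁ (inj₁ (sym wm≡u))
    ... | inj₁ s<m with m≤n⇒m<n∨m≡n s<m
    ... | inj₂ refl  = inj₁ (inj₂ (sym wm≡u))
    ... | inj₁ 1+s<m = inj₂ (m , 1+s<m , m<e , wm≡u)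

-- Attaching one odd ear to a vertex set.

-- The L positions starting at s ≤ 1 meet the two ends 0 and L of an ear exactly in p.
data Window (L : ℕ) : ℕ → ℕ → Set where
  from-start : Window L 0 0
  from-end   : Window L 1 L

-- `inner-inj` compares interior positions with all others but never 0 with `L`, so paths and closed
-- ears are treated alike, and so is the base circuit attached to its base vertex.
record Attached {n} (G : Graph n) (A : Pred (Fin n) 0ℓ) (w : ℕ → Fin n) (L : ℕ) : Set where
  field
    start∈    : A (w 0)
    end∈      : A (w L)
    inner∉    : ∀ {m} → 0 < m → m < L → ¬ A (w m)
    inner-inj : ∀ {m m′} → 0 < m → m < L → m′ ≤ L → w m ≡ w m′ → m ≡ m′
    edge      : ∀ {m} → m < L → E G (w m) (w (suc m))
    odd       : Odd L

  L-split : ∃[ d ] L ≡ suc (d * 2)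
  L-split = odd⇒1+2* L odd

  0<L : 0 < L
  0<L = subst (0 <_) (sym (proj₂ L-split)) (s≤s z≤n)

  On : Pred (Fin n) 0ℓ
  On = Segment w 0 (suc L)

  position : ∀ {m} → m ≤ L → (m ≡ 0 ⊎ m ≡ L) ⊎ (0 < m × m < L)
  position {zero}  _   = inj₁ (inj₁ refl)
  position {suc m} m≤L with m≤n⇒m<n∨m≡n m≤L
  ... | inj₁ m<L = inj₂ (s≤s z≤n , m<L)
  ... | inj₂ m≡L = inj₁ (inj₂ m≡L)

  -- The last hypothesis excludes only the pair 0, `L`, whose vertices coincide on a closed ear.
  distinct : ∀ {m m′} → m < m′ → m′ ≤ L → 0 < m ⊎ m′ < L → w m ≢ w m′
  distinct m<m′ m′≤L (inj₁ 0<m) eq =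
    <⇒≢ m<m′ (inner-inj 0<m (<-≤-trans m<m′ m′≤L) m′≤L eq)
  distinct m<m′ m′≤L (inj₂ m′<L) eq =
    <⇒≢ m<m′ (sym (inner-inj (≤-<-trans z≤n m<m′) m′<L (≤-trans (<⇒≤ m<m′) m′≤L) (sym eq)))

  -- As `L` is odd, there are evenly many interior positions 1, ..., `L` - 1, and they are paired
  -- from position 1 on.
  interior : EdgeSet n
  interior = alternate w 1 (proj₁ L-split)

  -- Both ends of the ear lie in `A`, so only its interior is new, and that is disjoint from `A`.
  Matches-outside : ∀ {v M} → A v → Matches G (A ⊖ v) M →
    Matches G ((A ∪ On) ⊖ v) (M ++ interior)
  Matches-outside {v} Av mM = Matches-resp-≐ G (to , from)
    (Matches-++ G (λ { (Au , _) (m , 0<m , m<L , refl) → inner∉ 0<m m<L Au }) mM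
      (Matches-alternate G w (proj₁ L-split) {1} (sym (proj₂ L-split))
        (λ _ m<L → edge (<⇒≤ m<L))
        (λ 0<m m<m′ m′<L → distinct m<m′ (<⇒≤ m′<L) (inj₁ 0<m))))
    where
    to : ∀ {u} → ((A ⊖ v) ∪ Segment w 1 L) u → ((A ∪ On) ⊖ v) u
    to (inj₁ (Au , u≢v)) = inj₁ Au , u≢v
    to (inj₂ (m , 0<m , m<L , refl)) =
      inj₂ (m , z≤n , <⇒≤ (s≤s m<L) , refl) , λ { refl → inner∉ 0<m m<L Av }
    from : ∀ {u} → ((A ∪ On) ⊖ v) u → ((A ⊖ v) ∪ Segment w 1 L) u
    from (inj₁ Au , u≢v) = inj₁ (Au , u≢v)
    from (inj₂ (m , _ , s≤s m≤L , refl) , u≢v) with position m≤L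
    ... | inj₁ (inj₁ refl) = inj₁ (start∈ , u≢v)
    ... | inj₁ (inj₂ refl) = inj₁ (end∈ , u≢v)
    ... | inj₂ (0<m , m<L) = inj₂ (m , 0<m , m<L , refl)

  window-≤ : ∀ {s p m} → Window L s p → m < s + L → m ≤ L
  window-≤ from-start m<e = <⇒≤ m<e
  window-≤ from-end   m<e = ≤-pred m<e

  inner-window : ∀ {s p m} → Window L s p → 0 < m → m < L → s ≤ m × m < s + L
  inner-window from-start 0<m m<L = z≤n , m<L
  inner-window from-end   0<m m<L = 0<m , <⇒≤ (s≤s m<L)

  end-window : ∀ {s p} → Window L s p → s ≤ p × p < s + L
  end-window from-start = z≤n , 0<L
  end-window from-end   = 0<L , ≤-refl

  window-distinct : ∀ {s p m m′} → Window L s p →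
    s ≤ m → m < m′ → m′ < s + L → w m ≢ w m′
  window-distinct from-start _   m<m′ m′<e = distinct m<m′ (<⇒≤ m′<e) (inj₂ m′<e)
  window-distinct from-end   0<m m<m′ m′<e = distinct m<m′ (≤-pred m′<e) (inj₁ 0<m)

  window-A : ∀ {s p m} → Window L s p → s ≤ m → m < s + L → A (w m) → m ≡ p
  window-A W s≤m m<e Am with position (window-≤ W m<e) | W
  ... | inj₂ (0<m , m<L) | _          = ⊥-elim (inner∉ 0<m m<L Am)
  ... | inj₁ (inj₁ refl) | from-start = refl
  ... | inj₁ (inj₁ refl) | from-end   = case s≤m of λ ()
  ... | inj₁ (inj₂ refl) | from-start = ⊥-elim (<-irrefl refl m<e)
  ... | inj₁ (inj₂ refl) | from-end   = refl

  -- The window meets `A` only in `w p`, the vertex that `M` misses, so it is disjoint from what `M`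
  -- covers. Removing position `t` leaves two stretches of even length, each paired off separately;
  -- `t` may be `p` itself.
  Matches-split : ∀ {s p c d t M} → Window L s p →
    s + c * 2 ≡ t → suc t + d * 2 ≡ s + L → Matches G (A ⊖ w p) M →
    Matches G ((A ∪ On) ⊖ w t) (M ++ (alternate w s c ++ alternate w (suc t) d))
  Matches-split {s} {p} {c} {d} {t} W eqₜ eq mM = Matches-resp-≐ G (to , from)
    (Matches-++ G disj mM
      (Matches-++ G
        (λ { (m , s≤m , m<t , refl) (m′ , t<m′ , m′<e , eq) →
           window-distinct W s≤m (<-trans m<t t<m′) m′<e (sym eq) })
        (Matches-alternate G w c eqₜ
          (λ s≤m m<t → edge (window-≤ W (<-trans m<t t<s+L)))
          (λ s≤m m<m′ m′<t → window-distinct W s≤m m<m′ (<-trans m′<t t<s+L)))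
        (Matches-alternate G w d eq
          (λ t<m m<e → edge (window-≤ W m<e))
          (λ t<m m<m′ m′<e → window-distinct W (≤-trans s≤t (<⇒≤ t<m)) m<m′ m′<e))))
    where
    s≤t : s ≤ t
    s≤t = ≤-trans (m≤m+n s (c * 2)) (≤-reflexive eqₜ)
    t<s+L : t < s + L
    t<s+L = ≤-trans (m≤m+n (suc t) (d * 2)) (≤-reflexive eq)
    place : ∀ {m} → s ≤ m → m < s + L → w m ≢ w t →
      (Segment w s t ∪ Segment w (suc t) (s + L)) (w m)
    place {m} s≤m m<e m≢t with <-cmp m t
    ... | tri< m<t _ _  = inj₁ (m , s≤m , m<t , refl)
    ... | tri≈ _ refl _ = ⊥-elim (m≢t refl)
    ... | tri> _ _ t<m  = inj₂ (m , t<m , m<e , refl)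
    disj : ∀ {u} → (A ⊖ w p) u → ¬ (Segment w s t ∪ Segment w (suc t) (s + L)) u
    disj (Au , u≢p) (inj₁ (m , s≤m , m<t , refl)) =
      u≢p (cong w (window-A W s≤m (<-trans m<t t<s+L) Au))
    disj (Au , u≢p) (inj₂ (m , t<m , m<e , refl)) =
      u≢p (cong w (window-A W (≤-trans s≤t (<⇒≤ t<m)) m<e Au))
    to : ∀ {u} → ((A ⊖ w p) ∪ (Segment w s t ∪ Segment w (suc t) (s + L))) u →
      ((A ∪ On) ⊖ w t) u
    to (inj₁ (Au , u≢p)) =
      inj₁ Au , λ { refl → u≢p (cong w (window-A W s≤t t<s+L Au)) }
    to (inj₂ (inj₁ (m , s≤m , m<t , refl))) =
      inj₂ (m , z≤n , s≤s (window-≤ W (<-trans m<t t<s+L)) , refl) ,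
      window-distinct W s≤m m<t t<s+L
    to (inj₂ (inj₂ (m , t<m , m<e , refl))) =
      inj₂ (m , z≤n , s≤s (window-≤ W m<e) , refl) ,
      window-distinct W s≤t t<m m<e ∘ sym
    from-A : ∀ {u} → A u → u ≢ w t →
      ((A ⊖ w p) ∪ (Segment w s t ∪ Segment w (suc t) (s + L))) u
    from-A {u} Au u≢t with u Fin.≟ w p
    -- `M` does not cover `w p`; as a position of the window other than `t`, it falls into one of
    -- the two stretches.
    ... | yes refl = inj₂ (place (proj₁ (end-window W)) (proj₂ (end-window W)) u≢t)
    ... | no u≢p   = inj₁ (Au , u≢p)
    from : ∀ {u} → ((A ∪ On) ⊖ w t) u →
      ((A ⊖ w p) ∪ (Segment w s t ∪ Segment w (suc t) (s + L))) u
    from (inj₁ Au , u≢t) = from-A Au u≢t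
    from (inj₂ (m , _ , s≤s m≤L , refl) , u≢t) with position m≤L
    ... | inj₁ (inj₁ refl) = from-A start∈ u≢t
    ... | inj₁ (inj₂ refl) = from-A end∈ u≢t
    ... | inj₂ (0<m , m<L) = inj₂ (place (proj₁ win) (proj₂ win) u≢t)
      where win = inner-window W 0<m m<L

  extend-critical : (∀ v → A v → ∃[ M ] Matches G (A ⊖ v) M) →
    ∀ v → (A ∪ On) v → ∃[ M ] Matches G ((A ∪ On) ⊖ v) M
  extend-critical crit v (inj₁ Av) = _ , Matches-outside Av (proj₂ (crit v Av))
  extend-critical crit v (inj₂ (t , _ , s≤s t≤L , refl)) with L-split | even⊎odd t
  -- For `t = 2c` and `L = 2h + 1` the window is 0, ..., `2h`, with `2c` positions before `t` and
  -- `2(h - c)` after it.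
  ... | h , L≡ | c , inj₁ refl with m≤n⇒∃[o]m+o≡n c≤h
    where
    c≤h : c ≤ h
    -- The bound `2c ≤ 2h + 1` is weakened to `2c < 2(h + 1)` so that the factor 2 can be cancelled.
    c≤h = ≤-pred (*-cancelʳ-< 2 c (suc h) (s≤s (≤-trans t≤L (≤-reflexive L≡))))
  ... | d , refl = _ , Matches-split {c = c} {d} from-start refl
    (trans (cong suc (sym (*-distribʳ-+ 2 c d))) (sym L≡)) (proj₂ (crit _ start∈))
  -- For `t = 2c + 1` the window is shifted to 1, ..., `L`, again with `2c` positions before `t` and
  -- `2(h - c)` after it.
  extend-critical crit v (inj₂ (t , _ , s≤s t≤L , refl))
      | h , L≡ | c , inj₂ refl with m≤n⇒∃[o]m+o≡n c≤h
    where
    c≤h : c ≤ h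
    c≤h = *-cancelʳ-≤ c h 2 (≤-pred (≤-trans t≤L (≤-reflexive L≡)))
  ... | d , refl = _ , Matches-split {c = c} {d} from-end refl
    (trans (cong (suc ∘ suc) (sym (*-distribʳ-+ 2 c d))) (cong suc (sym L≡))) (proj₂ (crit _ end∈))

-- Walks read at natural-number positions.

clamp : ∀ l → ℕ → Fin (suc l)
clamp l       zero    = Fin.zero
clamp zero    (suc m) = Fin.zero
clamp (suc l) (suc m) = Fin.suc (clamp l m)

toℕ-clamp : ∀ l {m} → m ≤ l → Fin.toℕ (clamp l m) ≡ m
toℕ-clamp l       {zero}  _         = refl
toℕ-clamp (suc l) {suc m} (s≤s m≤l) = cong suc (toℕ-clamp l m≤l)

clamp-toℕ : ∀ {l} (i : Fin (suc l)) → clamp l (Fin.toℕ i) ≡ i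
clamp-toℕ {l} i = Fin.toℕ-injective (toℕ-clamp l (Fin.toℕ≤pred[n] i))

clamp-inject₁ : ∀ {l} (i : Fin l) → clamp l (Fin.toℕ i) ≡ Fin.inject₁ i
clamp-inject₁ {l} i =
  trans (cong (clamp l) (sym (Fin.toℕ-inject₁ i))) (clamp-toℕ (Fin.inject₁ i))

clamp-fromℕ : ∀ l → clamp l l ≡ Fin.fromℕ l
clamp-fromℕ l = trans (cong (clamp l) (sym (Fin.toℕ-fromℕ l))) (clamp-toℕ (Fin.fromℕ l))

-- Positions beyond the length repeat the last vertex.
at : ∀ {n} → Walk n → ℕ → Fin n
at W m = vertex W (clamp (len W) m)

IsEar : ∀ {n} → Walk n → Set
IsEar W = (IsPath W × 1 ≤ len W) ⊎ IsCircuit W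

parity-suc : ∀ {r m} → parity r ≡ parity m → parity (suc r) ≡ parity (suc m)
parity-suc {r} {m} eq =
  -- `parity` recurses by two, so `suc-homo-⁻¹` at `suc r` expresses the parity of `suc r` as the
  -- inverse of that of `r`.
  trans (sym (suc-homo-⁻¹ (suc r))) (trans (cong _⁻¹ eq) (suc-homo-⁻¹ (suc m)))

module _ {n} (W : Walk n) where

  at-last : at W (len W) ≡ last W
  at-last = cong (vertex W) (clamp-fromℕ (len W))

  at-onWalk : ∀ m → at W m onWalk W
  at-onWalk m = _ , refl

  onWalk⇒Segment : ∀ {v} → v onWalk W → Segment (at W) 0 (suc (len W)) v
  onWalk⇒Segment (i , eq) =
    Fin.toℕ i , z≤n , Fin.toℕ<n i , trans (cong (vertex W) (clamp-toℕ i)) eq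

  EdgeOf⇒at : ∀ {a b} → EdgeOf W a b → ∃[ m ] (m < len W ×
    ((at W m ≡ a × at W (suc m) ≡ b) ⊎ (at W m ≡ b × at W (suc m) ≡ a)))
  EdgeOf⇒at (i , ends) = Fin.toℕ i , Fin.toℕ<n i ,
    [ (λ (p , q) → inj₁ (trans lower p , trans upper q))
    , (λ (p , q) → inj₂ (trans lower p , trans upper q)) ]′ ends
    where
    lower : at W (Fin.toℕ i) ≡ vertex W (Fin.inject₁ i)
    lower = cong (vertex W) (clamp-inject₁ i)
    upper : at W (suc (Fin.toℕ i)) ≡ vertex W (Fin.suc i)
    upper = cong (vertex W) (clamp-toℕ (Fin.suc i))

  at⇒EdgeOf : ∀ {m} → m < len W → EdgeOf W (at W m) (at W (suc m))
  at⇒EdgeOf m<l = Fin.fromℕ< m<l , inj₁ (cong (vertex W) lower , cong (vertex W) upper)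
    where
    lower = trans (sym (clamp-inject₁ (Fin.fromℕ< m<l))) (cong (clamp _) (Fin.toℕ-fromℕ< m<l))
    upper = trans (sym (clamp-toℕ (Fin.suc (Fin.fromℕ< m<l))))
      (cong (clamp _ ∘ suc) (Fin.toℕ-fromℕ< m<l))

  at-injective : IsPath W → ∀ {m m′} → m ≤ len W → m′ ≤ len W → at W m ≡ at W m′ → m ≡ m′
  at-injective inj m≤ m′≤ eq =
    trans (sym (toℕ-clamp _ m≤)) (trans (cong Fin.toℕ (inj eq)) (toℕ-clamp _ m′≤))

  at-circuit-injective : IsCircuit W → ∀ {m m′} → m < len W → m′ < len W →
    at W m ≡ at W m′ → m ≡ m′
  at-circuit-injective (_ , _ , inj) m< m′< eq = Fin.fromℕ<-injective _ _ m< m′< (inj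
    (trans (sym (lower m<)) (trans eq (lower m′<))))
    where
    lower : ∀ {m} (m< : m < len W) → at W m ≡ vertex W (Fin.inject₁ (Fin.fromℕ< m<))
    lower m< = trans (cong (at W) (sym (Fin.toℕ-fromℕ< m<)))
      (cong (vertex W) (clamp-inject₁ (Fin.fromℕ< m<)))

  at-inner-injective : IsEar W → ∀ {m m′} → 0 < m → m < len W → m′ ≤ len W →
    at W m ≡ at W m′ → m ≡ m′
  at-inner-injective (inj₁ (path , _)) _ m< m′≤ eq = at-injective path (<⇒≤ m<) m′≤ eq
  at-inner-injective (inj₂ circuit@(_ , closed , _)) 0<m m< m′≤ eq with m≤n⇒m<n∨m≡n m′≤
  ... | inj₁ m′<  = at-circuit-injective circuit m< m′< eq
  -- The final position of a circuit carries the same vertex as position 0, so `m` would have to be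
  -- 0.
  ... | inj₂ refl = contradiction
    (at-circuit-injective circuit m< (<-trans 0<m m<) (trans eq (trans at-last (sym closed))))
    (<⇒≢ 0<m ∘ sym)

  inner≢endpoint : IsEar W → ∀ {m} → 0 < m → m < len W → ¬ IsEndpoint (at W m) W
  inner≢endpoint ear 0<m m< (inj₁ eq) =
    <⇒≢ 0<m (sym (at-inner-injective ear 0<m m< z≤n eq))
  inner≢endpoint ear 0<m m< (inj₂ eq) =
    <⇒≢ m< (at-inner-injective ear 0<m m< ≤-refl (trans eq (sym at-last)))

-- Parity of subpaths of an ear.

-- Along P every step of Q changes the position by one; as Q cannot enter position t + 1,
-- it can only end at position 0.
subpath-parity : ∀ {n} {P Q : Walk n} → IsEar P → IsPath Q → Q ⊑ P →
  IsEndpoint (last Q) P → ∀ {t} → t < len P → ¬ (at P (suc t) onWalk Q) →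
  ∀ r {s m} → s + r ≡ len Q → m ≤ t → at Q s ≡ at P m → parity r ≡ parity m
subpath-parity ear pathQ Q⊑P end t< avoid zero {m = zero} s≡ m≤t eq = refl
subpath-parity {P = P} {Q} ear pathQ Q⊑P end t< avoid zero {s} {suc m} s≡ m≤t eq =
  contradiction (subst (λ v → IsEndpoint v P) last≡ end)
    (inner≢endpoint P ear (s≤s z≤n) (≤-<-trans m≤t t<))
  where
  last≡ : last Q ≡ at P (suc m)
  last≡ = trans (sym (at-last Q))
    (trans (cong (at Q) (trans (sym s≡) (+-identityʳ s))) eq)
subpath-parity {P = P} {Q} ear pathQ Q⊑P end {t} t< avoid (suc r) {s} {m} s+r≡ m≤t eq
  with EdgeOf⇒at P (proj₂ Q⊑P (at⇒EdgeOf Q s<))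
  where
  s< : s < len Q
  s< = subst (s <_) s+r≡ (m<m+n s (s≤s z≤n))
... | p , p< , ends = step ends
  where
  s< : s < len Q
  s< = subst (s <_) s+r≡ (m<m+n s (s≤s z≤n))
  s+r≡′ : suc s + r ≡ len Q
  s+r≡′ = trans (sym (+-suc s r)) s+r≡
  unique : ∀ {m p} → m ≤ t → at Q s ≡ at P m → p ≤ len P → at P p ≡ at Q s → m ≡ p
  unique {suc m} m≤t eq p≤ eq′ =
    at-inner-injective P ear (s≤s z≤n) (≤-<-trans m≤t t<) p≤ (sym (trans eq′ eq))
  -- Position 0 can be confused with another one only on a closed ear. There both endpoints are the
  -- base vertex, so `Q` would already stand at its last vertex although steps remain.
  unique {zero} m≤t eq p≤ eq′ =
    [ (λ (path , _) → at-injective P path z≤n p≤ (sym (trans eq′ eq)))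
    , (λ (_ , closed , _) → contradiction (ends-early closed) (<⇒≢ s<)) ]′ ear
    where
    ends-early : first P ≡ last P → s ≡ len Q
    ends-early closed = at-injective Q pathQ (<⇒≤ s<) ≤-refl (trans eq
      (trans (sym ([ (λ z → z) , (λ z → trans z (sym closed)) ]′ end)) (sym (at-last Q))))
  step : (at P p ≡ at Q s × at P (suc p) ≡ at Q (suc s)) ⊎
         (at P p ≡ at Q (suc s) × at P (suc p) ≡ at Q s) → parity (suc r) ≡ parity m
  step (inj₁ (here≡ , next≡)) with unique m≤t eq (<⇒≤ p<) here≡
  ... | refl with m≤n⇒m<n∨m≡n m≤t
  -- A forward step from position `t` would land on the forbidden vertex.
  ... | inj₂ refl = contradiction (subst (_onWalk Q) (sym next≡) (at-onWalk Q (suc s))) avoid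
  ... | inj₁ m<t = parity-suc {r} {suc m}
    (subpath-parity ear pathQ Q⊑P end t< avoid r s+r≡′ m<t (sym next≡))
  step (inj₂ (next≡ , here≡)) with unique m≤t eq p< here≡
  ... | refl = parity-suc {r} {p}
    (subpath-parity ear pathQ Q⊑P end t< avoid r s+r≡′ (<⇒≤ m≤t) (sym next≡))

-- Deleted vertices and induction over the ears.

x∈p─q⇒x∉q : ∀ {n} {x : Fin n} (p q : Subset n) → x ∈ p ─ q → ¬ x ∈ q
x∈p─q⇒x∉q (_ ∷ p) (outside ∷ q) (there x∈) (there x∈q) = x∈p─q⇒x∉q p q x∈ x∈q
x∈p─q⇒x∉q (_ ∷ p) (inside  ∷ q) (there x∈) (there x∈q) = x∈p─q⇒x∉q p q x∈ x∈q

-- The start `i` is arbitrary: criticality of prefixes starts at 0, whereas the matching through the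
-- odd edge starts just after the ear of that edge.
ear-induction : ∀ {k} (Q : ℕ → Set) {i} → Q i →
  (∀ (l : Fin (suc k)) → i ≤ Fin.toℕ l → Q (Fin.toℕ l) → Q (suc (Fin.toℕ l))) →
  ∀ j → i ≤ j → j ≤ suc k → Q j
ear-induction Q Qi step j i≤j j≤ with m≤n⇒m<n∨m≡n i≤j
... | inj₂ refl = Qi
ear-induction Q Qi step (suc j) i≤j j< | inj₁ (s≤s i≤) =
  subst (Q ∘ suc) (Fin.toℕ-fromℕ< j<) (step (Fin.fromℕ< j<)
    (subst (_ ≤_) (sym (Fin.toℕ-fromℕ< j<)) i≤)
    (subst Q (sym (Fin.toℕ-fromℕ< j<)) (ear-induction Q Qi step j i≤ (<⇒≤ j<))))

-- Prefixes of the ear-decomposition and their matchings.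

module _ {n k} {G : Graph n} (D : EarDecomposition G k) where

  isEar : ∀ l → IsEar (ear-walk D l)
  isEar Fin.zero    = inj₂ (base D)
  isEar (Fin.suc i) = ears D i

  Ear-unique : ∀ {v i j} → Ear D v i → Ear D v j → i ≡ j
  Ear-unique {i = i} {j} (v∈i , first-i) (v∈j , first-j) with Fin.<-cmp i j
  ... | tri< i<j _ _ = contradiction v∈i (first-j i i<j)
  ... | tri≈ _ i≡j _ = i≡j
  ... | tri> _ _ j<i = contradiction v∈j (first-i j j<i)

  -- On an ear before `i` the edge would put `a` on too early an ear. On an ear after `i` both ends
  -- of the edge are shared with `P_i`, hence endpoints of the later ear, and consecutive positions
  -- are both endpoints only if that ear is a single edge.
  nontrivial-ear : ∀ {a b i l} → Ear D a i → Ear D b i →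
    EdgeOf (ear-walk D l) a b → Nontrivial D l → l ≡ i
  nontrivial-ear {i = i} {l} (a∈i , a-first) (b∈i , _) ab∈l nontriv with Fin.<-cmp l i
  ... | tri≈ _ l≡i _ = l≡i
  ... | tri< l<i _ _ = contradiction (edge-onWalk ab∈l) (a-first l l<i)
    where
    edge-onWalk : ∀ {a b} {W : Walk n} → EdgeOf W a b → a onWalk W
    edge-onWalk (t , inj₁ (eq , _)) = _ , eq
    edge-onWalk (t , inj₂ (_ , eq)) = _ , eq
  nontrivial-ear {a} {b} {i} {Fin.suc l} (a∈i , _) (b∈i , _) ab∈l nontriv | tri> _ _ i<l =
    contradiction (trivial (EdgeOf⇒at P ab∈l)) nontriv
    where
    P = ear-walk D (Fin.suc l)
    endpoint : ∀ {v} m → v onWalk ear-walk D i → at P m ≡ v → IsEndpoint (at P m) P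
    endpoint m v∈i refl = Equivalence.to (shared D l (at-onWalk P m)) (i , i<l , v∈i)
    both-endpoints : ∀ t → t < len P → IsEndpoint (at P t) P → IsEndpoint (at P (suc t)) P →
      len P ≡ 1
    -- Either `suc t` is interior, or it is the final position; in the latter case `t` is interior
    -- unless it is 0.
    both-endpoints t t< end end′ with m≤n⇒m<n∨m≡n t<
    both-endpoints t       t< end end′ | inj₁ 1+t< =
      contradiction end′ (inner≢endpoint P (ears D l) (s≤s z≤n) 1+t<)
    both-endpoints zero    t< end end′ | inj₂ 1≡ = sym 1≡
    both-endpoints (suc t) t< end end′ | inj₂ _ =
      contradiction end (inner≢endpoint P (ears D l) (s≤s z≤n) t<)
    trivial : ∃[ t ] (t < len P ×
      ((at P t ≡ a × at P (suc t) ≡ b) ⊎ (at P t ≡ b × at P (suc t) ≡ a))) → len P ≡ 1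
    trivial (t , t< , inj₁ (p , q)) =
      both-endpoints t t< (endpoint t a∈i p) (endpoint (suc t) b∈i q)
    trivial (t , t< , inj₂ (p , q)) =
      both-endpoints t t< (endpoint t b∈i p) (endpoint (suc t) a∈i q)

  -- The base vertex is included from the start, so that P₀ too is an ear attached to Prefix 0.
  Prefix : ℕ → Pred (Fin n) 0ℓ
  Prefix j v = v ≡ first (ear-walk D Fin.zero) ⊎
    ∃[ l ] (Fin.toℕ l < j × v onWalk ear-walk D l)

  module _ (odd : OddDecomposition D) where

    attached : ∀ l → Attached G (Prefix (Fin.toℕ l)) (at (ear-walk D l)) (len (ear-walk D l))
    attached l = record
      { start∈    = start∈ l
      ; end∈      = end∈ l
      ; inner∉    = inner∉ l
      ; inner-inj = at-inner-injective (ear-walk D l) (isEar l)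
      ; edge      = λ m< → edges-⊆ D l (at⇒EdgeOf (ear-walk D l) m<)
      ; odd       = odd l
      }
      where
      start∈ : ∀ l → Prefix (Fin.toℕ l) (at (ear-walk D l) 0)
      start∈ Fin.zero    = inj₁ refl
      start∈ (Fin.suc i) = inj₂ (Equivalence.from (shared D i (_ , refl)) (inj₁ refl))
      end∈ : ∀ l → Prefix (Fin.toℕ l) (at (ear-walk D l) (len (ear-walk D l)))
      end∈ Fin.zero =
        inj₁ (trans (at-last (ear-walk D Fin.zero)) (sym (proj₁ (proj₂ (base D)))))
      end∈ (Fin.suc i) = inj₂ (Equivalence.from (shared D i (_ , refl))
        (inj₂ (at-last (ear-walk D (Fin.suc i)))))
      inner∉ : ∀ l {m} → 0 < m → m < len (ear-walk D l) →
        ¬ Prefix (Fin.toℕ l) (at (ear-walk D l) m)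
      inner∉ Fin.zero 0<m m< (inj₁ eq) =
        inner≢endpoint (ear-walk D Fin.zero) (isEar Fin.zero) 0<m m< (inj₁ eq)
      -- The base vertex lies on `P₀`, so `shared` would make this interior vertex an endpoint.
      inner∉ (Fin.suc i) 0<m m< (inj₁ eq) =
        inner≢endpoint (ear-walk D (Fin.suc i)) (ears D i) 0<m m<
          (Equivalence.to (shared D i (_ , refl)) (Fin.zero , s≤s z≤n , Fin.zero , sym eq))
      inner∉ (Fin.suc i) 0<m m< (inj₂ earlier) =
        inner≢endpoint (ear-walk D (Fin.suc i)) (ears D i) 0<m m<
          (Equivalence.to (shared D i (_ , refl)) earlier)

    Prefix-suc : ∀ l → (Prefix (Fin.toℕ l) ∪ Attached.On (attached l)) ≐ Prefix (suc (Fin.toℕ l))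
    Prefix-suc l = to , from
      where
      to : ∀ {u} → (Prefix (Fin.toℕ l) ∪ Attached.On (attached l)) u → Prefix (suc (Fin.toℕ l)) u
      to (inj₁ (inj₁ base≡))          = inj₁ base≡
      to (inj₁ (inj₂ (i , i<l , u∈))) = inj₂ (i , m<n⇒m<1+n i<l , u∈)
      to (inj₂ (m , _ , _ , eq))      = inj₂ (l , ≤-refl , _ , eq)
      from : ∀ {u} → Prefix (suc (Fin.toℕ l)) u → (Prefix (Fin.toℕ l) ∪ Attached.On (attached l)) u
      from (inj₁ base≡) = inj₁ (inj₁ base≡)
      from (inj₂ (i , s≤s i≤l , u∈)) with m≤n⇒m<n∨m≡n i≤l
      ... | inj₁ i<l = inj₁ (inj₂ (i , i<l , u∈))
      ... | inj₂ i≡l with Fin.toℕ-injective i≡l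
      ... | refl = inj₂ (onWalk⇒Segment (ear-walk D l) u∈)

    Prefix-suc-⊖ : ∀ l v →
      ((Prefix (Fin.toℕ l) ∪ Attached.On (attached l)) ⊖ v) ≐ (Prefix (suc (Fin.toℕ l)) ⊖ v)
    Prefix-suc-⊖ l v =
        (λ (u∈ , u≢v) → proj₁ (Prefix-suc l) u∈ , u≢v)
      , (λ (u∈ , u≢v) → proj₂ (Prefix-suc l) u∈ , u≢v)

    -- `Prefix 0` is the base vertex alone, where the empty matching serves; each ear, the base
    -- circuit included, is then added by `extend-critical`.
    Prefix-critical : ∀ j → j ≤ suc k →
      ∀ v → Prefix j v → ∃[ M ] Matches G (Prefix j ⊖ v) M
    Prefix-critical j = ear-induction (λ j → ∀ v → Prefix j v → ∃[ M ] Matches G (Prefix j ⊖ v) M)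
      empty (λ l _ → step l) j z≤n
      where
      empty : ∀ v → Prefix 0 v → ∃[ M ] Matches G (Prefix 0 ⊖ v) M
      empty v (inj₁ v≡) = _ , Matches-[] G λ { u (inj₁ u≡ , u≢v) → u≢v (trans u≡ (sym v≡)) }
      step : ∀ l → (∀ v → Prefix (Fin.toℕ l) v → ∃[ M ] Matches G (Prefix (Fin.toℕ l) ⊖ v) M) →
        ∀ v → Prefix (suc (Fin.toℕ l)) v → ∃[ M ] Matches G (Prefix (suc (Fin.toℕ l)) ⊖ v) M
      step l critical v v∈
        with Attached.extend-critical (attached l) critical v (proj₂ (Prefix-suc l) v∈)
      ... | M , mM = M , Matches-resp-≐ G (Prefix-suc-⊖ l v) mM

    Prefix-extend : ∀ l {v M} → Prefix (Fin.toℕ l) v → Matches G (Prefix (Fin.toℕ l) ⊖ v) M →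
      Matches G (Prefix (suc (Fin.toℕ l)) ⊖ v) (M ++ Attached.interior (attached l))
    Prefix-extend l {v} v∈ mM =
      Matches-resp-≐ G (Prefix-suc-⊖ l v) (Attached.Matches-outside (attached l) v∈ mM)

    -- The odd subpath from position `t` avoids position `t + 1`, so by `subpath-parity` its length
    -- has the parity of `t`. Hence `t` is odd, and `interior` uses exactly the edges leaving odd
    -- positions.
    interior-∋ : ∀ {x y i t} → OddlyJoined D i x y → t < len (ear-walk D i) →
      at (ear-walk D i) t ≡ x → at (ear-walk D i) (suc t) ≡ y →
      (x , y) ∈ˡ Attached.interior (attached i)
    interior-∋ {i = i} {t} (Q , pathQ , Q⊑P , first≡ , end , oddQ , y∉Q) t< refl refl
      with odd⇒1+2* t (trans (sym (subpath-parity (isEar i) pathQ Q⊑P end t< y∉Q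
             (len Q) {0} refl ≤-refl first≡)) oddQ)
    ... | c , refl = alternate-∋ (at (ear-walk D i)) 1 (*-cancelʳ-< 2 c _
      (≤-pred (≤-trans t< (≤-reflexive (proj₂ (Attached.L-split (attached i)))))))

    -- Adding the interior matching of an ear only enlarges the matching, so the edge gained at ear
    -- `i` survives all later ears. Membership of `v` in the prefix is carried along because each
    -- extension needs the missed vertex to be an old one.
    Prefix-matching : ∀ {a b v} i → Prefix (Fin.toℕ i) v →
      Contains (Attached.interior (attached i)) a b →
      ∃[ M ] (Matches G (Prefix (suc k) ⊖ v) M × Contains M a b)
    Prefix-matching {a} {b} {v} i v∈ ab∈ =
      proj₂ (ear-induction
        (λ j → Prefix j v × ∃[ M ] (Matches G (Prefix j ⊖ v) M × Contains M a b))
        first-step (λ l _ → step l) (suc k) (Fin.toℕ<n i) ≤-refl)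
      where
      mM = Prefix-critical (Fin.toℕ i) (<⇒≤ (Fin.toℕ<n i)) v v∈
      first-step : Prefix (suc (Fin.toℕ i)) v ×
        ∃[ M ] (Matches G (Prefix (suc (Fin.toℕ i)) ⊖ v) M × Contains M a b)
      first-step = proj₁ (Prefix-suc i) (inj₁ v∈) ,
        _ , Prefix-extend i v∈ (proj₂ mM) , Any.++⁺ʳ (proj₁ mM) ab∈
      step : ∀ l → Prefix (Fin.toℕ l) v ×
          ∃[ M ] (Matches G (Prefix (Fin.toℕ l) ⊖ v) M × Contains M a b) →
        Prefix (suc (Fin.toℕ l)) v ×
          ∃[ M ] (Matches G (Prefix (suc (Fin.toℕ l)) ⊖ v) M × Contains M a b)
      step l (v∈ , M , mM , ab∈M) = proj₁ (Prefix-suc l) (inj₁ v∈) ,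
        _ , Prefix-extend l v∈ mM , Any.++⁺ˡ ab∈M

-- Conclusion for the whole graph.

-- Every end of an edge of `M` is a covered vertex, hence differs from `v`; so the edges survive in
-- `G ∖ v`.
Matches⇒perfect : ∀ {n} {G : Graph n} {A : Pred (Fin n) 0ℓ} {v M} →
  (∀ {u} → u ∈ V G → A u) → Matches G (A ⊖ v) M → IsPerfectMatching (G ∖ v) M
Matches⇒perfect {G = G} {v = v} V⊆A ((M⊆E , disj) , M⊆A , A⊆M) =
    ( All.tabulate (λ e∈M → All.lookup M⊆E e∈M
        , proj₂ (M⊆A (lose e∈M (inj₁ refl)))
        , proj₂ (M⊆A (lose e∈M (inj₂ refl))))
    , disj)
  , λ u u∈ → A⊆M
      ( V⊆A (p─q⊆p (V G) _ u∈)
      , λ { refl → x∈p─q⇒x∉q (V G) _ u∈ (x∈⁅x⁆ u) })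

lemma2p1 : ∀ {n k : ℕ} (G : Graph n) → FactorCritical G →
    (D : EarDecomposition G k) → OddDecomposition D →
    ∀ (a b : Fin n) → OddEdge D a b →
    ∃[ i ] (EdgeOf (ear-walk D i) a b × Nontrivial D i) →
    ∀ (v : Fin n) → v ∈ V G →
    ∀ {i j} → Ear D v j → Ear D a i → Ear D b i → j Fin.< i →
    ∃[ M ] (IsPerfectMatching (G ∖ v) M × Contains M a b)
lemma2p1 {k = k} G _ D odd a b (_ , i₀ , a∈i₀ , _ , joined) (l , ab∈l , nontriv) v _
  {i} {j} (v∈j , _) a∈i b∈i j<i
  -- The ear witnessing oddness and the nontrivial ear carrying the edge are both identified with
  -- `i`.
  with Ear-unique D a∈i₀ a∈i | nontrivial-ear D a∈i b∈i ab∈l nontriv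
... | refl | refl =
  let M , mM , ab∈M = Prefix-matching D odd i (inj₂ (j , j<i , v∈j)) contains
  in M , Matches⇒perfect {G = G} {A = Prefix D (suc k)} V⊆Prefix mM , ab∈M
  where
  -- An ear `j` before `i` exists, so `i` is not the base circuit and the odd subpaths are
  -- available.
  oddly = joined (≤-trans (s≤s z≤n) j<i)
  contains : Contains (Attached.interior (attached D odd i)) a b
  contains with EdgeOf⇒at (ear-walk D i) ab∈l
  -- The subpath to use starts at whichever of `a`, `b` comes first along the ear, since it must
  -- avoid the next position.
  ... | t , t< , inj₁ (p , q) = lose (interior-∋ D odd (proj₁ oddly) t< p q) (inj₁ refl)
  ... | t , t< , inj₂ (p , q) = lose (interior-∋ D odd (proj₂ oddly) t< p q) (inj₂ refl)
  V⊆Prefix : ∀ {u} → u ∈ V G → Prefix D (suc k) u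
  V⊆Prefix u∈ = let i , on = cover D u∈ in inj₂ (i , Fin.toℕ<n i , on)
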